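{- Let $k\ge0$ be an integer, let $\mathcal H$ be a hypergraph, and let $\vec{\mathcal H}$ and $\vec{\mathcal H}'$ be two $k$-hyperarc-connected orientations of $\mathcal H$. Then there is a sequence $\vec{\mathcal H}=\vec{\mathcal H}_0,\vec{\mathcal H}_1,\ldots,\vec{\mathcal H}_\ell=\vec{\mathcal H}'$ of $k$-hyperarc-connected orientations of $\mathcal H$ such that for each $1\le i\le \ell$, $\vec{\mathcal H}_i$ arises from $\vec{\mathcal H}_{i-1}$ by reversing one directed hypercycle or one directed hyperpath of $\vec{\mathcal H}_{i-1}$.
   Context: A hypergraph $\mathcal H=(V,\mathcal E)$ consists of a finite vertex set $V$ and a finite multiset $\mathcal E$ of nonempty subsets of $V$ (hyperedges). Orienting a hyperedge $Z$ towards a vertex $v\in Z$ yields the hyperarc $(Z\setminus\{v\},v)$, with tail set $Z\setminus\{v\}$ and head $v$. An orientation $\vec{\mathcal H}$ of $\mathcal H$ is obtained by orienting every hyperedge (it is the multiset of resulting hyperarcs). For $\emptyset\ne X\subsetneq V$, the out-degree $d^+(X)$ is the number of hyperarcs $(Y,v)$ with $v\notin X$ and $Y\cap X\neq\emptyset$; $\vec{\mathcal H}$ is $k$-hyperarc-connected if $d^+(X)\ge k$ for every $\emptyset\neq X\subsetneq V$. For vertices $s,t$, an $(s,t)$-hyperpath is a sequence $(A_1,a_1),\ldots,(A_\ell,a_\ell)$ ($\ell\ge1$) of hyperarcs of the orientation with $s\in A_1$, $a_\ell=t$, $a_i\in A_{i+1}$ for $1\le i\le \ell-1$, and $a_1,\ldots,a_\ell$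 pairwise distinct; if $s=t$ it is called a directed hypercycle. Reversing such a hyperpath or hypercycle means, with $a_0:=s$, replacing each hyperarc $(A_i,a_i)$ by $((A_i\setminus\{a_{i-1}\})\cup\{a_i\},a_{i-1})$, for $i=1,\ldots,\ell$. -}

module Defs where

open import Data.Nat using (ℕ; suc; _≤_)
open import Data.Fin using (Fin; zero; suc; inject₁; fromℕ)
open import Data.Fin.Subset using (Subset; _∈_; _∉_; _∩_; _∪_; _-_; ⁅_⁆; ⊤; _⊂_; Nonempty)
open import Data.Fin.Subset.Properties using (_∈?_; nonempty?)
open import Data.List using (List; []; _∷_; _++_; length; filter; map; tabulate)
open import Data.List.Relation.Unary.All using (All)
open import Data.List.Relation.Unary.Unique.Propositional using (Unique)
open import Data.List.Relation.Binary.Permutation.Propositional using (_↭_)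
import Data.List.Membership.Propositional as List
open import Data.Product using (_×_; ∃-syntax)
open import Relation.Nullary using (Dec; ¬?; _×-dec_)

-- The vertex set is Fin #V.  The multiset of hyperedges is given as a family
-- indexed by Fin #E, so parallel hyperedges are allowed.
record Hypergraph : Set where
  field
    #V       : ℕ
    #E       : ℕ
    edge     : Fin #E → Subset #V
    nonempty : ∀ e → Nonempty (edge e)

open Hypergraph public

record Hyperarc (n : ℕ) : Set where
  constructor _⇒_
  field
    tail : Subset n
    head : Fin n

open Hyperarc public

orient : ∀ {n} → Subset n → Fin n → Hyperarc n
orient Z v = (Z - v) ⇒ v

record Orientation (H : Hypergraph) : Set where
  field
    headOf   : Fin (#E H) → Fin (#V H)
    headOf∈  : ∀ e → headOf e ∈ edge H e

  hyperarcs : List (Hyperarc (#V H))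
  hyperarcs = tabulate λ e → orient (edge H e) (headOf e)

open Orientation public

-- An orientation is the multiset of its hyperarcs: two orientations that differ
-- only by exchanging the heads of parallel hyperedges are the same orientation.
_≈_ : ∀ {H} → Orientation H → Orientation H → Set
O ≈ O′ = hyperarcs O ↭ hyperarcs O′

Leaves : ∀ {n} → Subset n → Hyperarc n → Set
Leaves X (Y ⇒ v) = v ∉ X × Nonempty (Y ∩ X)

leaves? : ∀ {n} (X : Subset n) (a : Hyperarc n) → Dec (Leaves X a)
leaves? X (Y ⇒ v) = ¬? (v ∈? X) ×-dec nonempty? (Y ∩ X)

d⁺ : ∀ {H} → Orientation H → Subset (#V H) → ℕ
d⁺ O X = length (filter (leaves? X) (hyperarcs O))

_-HyperarcConnected_ : ℕ → ∀ {H} → Orientation H → Set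
k -HyperarcConnected O = ∀ X → Nonempty X → X ⊂ ⊤ → k ≤ d⁺ O X

-- Chain s ((A₁ ⇒ a₁) ∷ … ∷ (Aₗ ⇒ aₗ) ∷ []) t  says that  ℓ ≥ 1,  s ∈ A₁,
-- aᵢ ∈ Aᵢ₊₁  for 1 ≤ i < ℓ,  and  aₗ = t.
data Chain {n} : Fin n → List (Hyperarc n) → Fin n → Set where
  last : ∀ {s A t} → s ∈ A → Chain s ((A ⇒ t) ∷ []) t
  step : ∀ {s A a P t} → s ∈ A → Chain a P t → Chain s ((A ⇒ a) ∷ P) t

-- The case s = t is not excluded: these are the directed hypercycles.
record IsHyperpath {H} (O : Orientation H) (s t : Fin (#V H))
                   (P : List (Hyperarc (#V H))) : Set where
  field
    chain         : Chain s P t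
    distinctHeads : Unique (map head P)
    inOrientation : All (List._∈ hyperarcs O) P

-- The first argument is a₀ = s, and in recursive calls aᵢ₋₁.
reversed : ∀ {n} → Fin n → List (Hyperarc n) → List (Hyperarc n)
reversed s []            = []
reversed s ((A ⇒ a) ∷ P) = (((A - s) ∪ ⁅ a ⁆) ⇒ s) ∷ reversed a P

-- O′ arises from O by replacing, in the multiset of hyperarcs, the hyperarcs of
-- one hyperpath or hypercycle P of O by their reversals; R is the multiset of
-- the remaining hyperarcs.
ArisesByReversal : ∀ {H} → Orientation H → Orientation H → Set
ArisesByReversal O O′ =
  ∃[ s ] ∃[ t ] ∃[ P ] ∃[ R ]
    IsHyperpath O s t P
    × hyperarcs O ↭ P ++ R
    × hyperarcs O′ ↭ reversed s P ++ R

record ReversalSequence (k : ℕ) {H} (O O′ : Orientation H) : Set where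
  field
    ℓ         : ℕ
    term      : Fin (suc ℓ) → Orientation H
    first     : term zero ≈ O
    final     : term (fromℕ ℓ) ≈ O′
    connected : ∀ i → k -HyperarcConnected (term i)
    reversal  : ∀ (i : Fin ℓ) → ArisesByReversal (term (inject₁ i)) (term (suc i))

{-# OPTIONS --safe #-}
module Submission where

-- The number of hyperarcs leaving X plus the number of heads in X is the number
-- of hyperedges meeting X, so k-hyperarc-connectivity depends only on the
-- in-degrees, and reversing an (s,t)-hyperpath just moves one unit of in-degree
-- from t to s.  If t has larger in-degree in O than in O′, some s with smaller
-- in-degree lies in no tight set (d⁺ = k) avoiding t: otherwise, by
-- submodularity of d⁺, tight sets avoiding t could be merged into disjoint ones
-- that cover all such s; none of them has fewer heads in O than in O′, so
-- summing over them contradicts the excess at t.  Reversing an (s,t)-hyperpath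
-- then keeps connectivity and brings the in-degrees closer.  Once the in-degrees
-- agree, the hyperedges whose heads differ decompose into directed hypercycles.

open import Algebra.Properties.CommutativeMonoid.Sum using ()
open import Data.Bool using (if_then_else_)
open import Data.Fin using (Fin; zero; suc; _≟_)
open import Data.Fin.Properties using (any?)
open import Data.Fin.Subset using (Subset; _∈_; _∉_; _∩_; _∪_; _-_; ⁅_⁆; ⊤; ⊥; ∁; _⊂_; _⊃_; Nonempty)
open import Data.Fin.Subset.Induction using (⊃-wellFounded)
open import Data.Fin.Subset.Properties
open import Data.List using (List; []; _∷_; _++_; length; filter; map; tabulate; allFin)
import Data.List.Membership.Propositional as List
open import Data.List.Membership.DecPropositional using () renaming (_∈?_ to ∈-dec)
open import Data.List.Membership.Propositional.Properties using (∈-allFin; ∈-∃++; ∈-++⁻; ∈-++⁺ˡ; ∈-++⁺ʳ)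
open import Data.List.Properties using (map-tabulate; tabulate-cong; map-++; map-∘)
open import Data.List.Relation.Binary.Permutation.Propositional using (_↭_; ↭-refl; ↭-reflexive; ↭-sym; ↭-trans; ↭⇒↭ₛ)
open import Data.List.Relation.Binary.Permutation.Propositional.Properties using (∈-resp-↭; map⁺; shift; ++⁺ˡ)
open import Data.List.Relation.Binary.Permutation.Setoid.Properties using (Unique-resp-↭)
open import Data.List.Relation.Unary.All as All using (All; []; _∷_)
open import Data.List.Relation.Unary.All.Properties using (¬Any⇒All¬)
open import Data.List.Relation.Unary.AllPairs using ([]; _∷_)
open import Data.List.Relation.Unary.Any using (here; there)
open import Data.List.Relation.Unary.Unique.Propositional using (Unique)
open import Data.List.Relation.Unary.Unique.Propositional.Properties using (allFin⁺)
import Data.List.Relation.Unary.Unique.Propositional.Properties as Unique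

open import Data.Nat using (ℕ; zero; suc; _+_; _*_; _∸_; _≤_; _<_; z≤n; s≤s; z<s; s≤s⁻¹; _≤?_; _<?_)
open import Data.Nat.Induction using (Acc; acc; <-wellFounded)
import Data.Nat.ListAction as ListAction
open import Data.Nat.ListAction.Properties using (sum-++; sum-↭)
open import Data.Nat.Properties hiding (_≟_; _≤?_; _<?_)
open import Data.Product using (_×_; _,_; proj₁; proj₂; ∃; ∃-syntax)
open import Data.Sum using (_⊎_; inj₁; inj₂; [_,_]′)
open import Data.Vec using (_∷_; there)
open import Function using (_∘_; id)
open import Relation.Binary.PropositionalEquality using (_≡_; _≢_; _≗_; refl; sym; trans; cong; cong₂; subst; setoid; module ≡-Reasoning)
open import Relation.Nullary using (Dec; yes; no; does; ¬_; ¬?; _×-dec_; contradiction)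
open import Relation.Nullary.Decidable using (decidable-stable)
open import Defs

open Algebra.Properties.CommutativeMonoid.Sum +-0-commutativeMonoid
  using (sum; sum-syntax; sum-cong-≗; ∑-distrib-+; ∑-comm; sum-replicate-zero)

-- Finite sums and indicators

𝟙 : ∀ {P : Set} → Dec P → ℕ
𝟙 P? = if does P? then 1 else 0

𝟙-yes : ∀ {P : Set} (P? : Dec P) → P → 𝟙 P? ≡ 1
𝟙-yes (yes _) _ = refl
𝟙-yes (no ¬p) p = contradiction p ¬p

𝟙-no : ∀ {P : Set} (P? : Dec P) → ¬ P → 𝟙 P? ≡ 0
𝟙-no (yes p) ¬p = contradiction p ¬p
𝟙-no (no _)  _  = refl

0<𝟙⇒ : ∀ {P : Set} (P? : Dec P) → 0 < 𝟙 P? → P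
0<𝟙⇒ (yes p) _ = p

𝟙-mono : ∀ {P Q : Set} (P? : Dec P) (Q? : Dec Q) → (P → Q) → 𝟙 P? ≤ 𝟙 Q?
𝟙-mono (no _)  _  _ = z≤n
𝟙-mono (yes p) Q? f = ≤-reflexive (sym (𝟙-yes Q? (f p)))

𝟙-cong : ∀ {P Q : Set} (P? : Dec P) (Q? : Dec Q) → (P → Q) → (Q → P) → 𝟙 P? ≡ 𝟙 Q?
𝟙-cong (yes p) Q? f _ = sym (𝟙-yes Q? (f p))
𝟙-cong (no ¬p) Q? _ g = sym (𝟙-no Q? (¬p ∘ g))

𝟙-submodular : ∀ {P Q R S : Set} (P? : Dec P) (Q? : Dec Q) (R? : Dec R) (S? : Dec S) →
               (P → R ⊎ S) → (Q → R ⊎ S) → (P → Q → R × S) →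
               𝟙 P? + 𝟙 Q? ≤ 𝟙 R? + 𝟙 S?
𝟙-submodular (no _) (no _) _ _ _ _ _ = z≤n
𝟙-submodular (yes p) (yes q) R? S? _ _ f with f p q
... | r , s rewrite 𝟙-yes R? r | 𝟙-yes S? s = ≤-refl
𝟙-submodular (yes p) (no _) R? S? f _ _ with f p
... | inj₁ r rewrite 𝟙-yes R? r = s≤s z≤n
... | inj₂ s rewrite 𝟙-yes S? s = m≤n+m 1 (𝟙 R?)
𝟙-submodular (no _) (yes q) R? S? _ f _ with f q
... | inj₁ r rewrite 𝟙-yes R? r = s≤s z≤n
... | inj₂ s rewrite 𝟙-yes S? s = m≤n+m 1 (𝟙 R?)

∑-mono-≤ : ∀ {n} {f g : Fin n → ℕ} → (∀ i → f i ≤ g i) → sum f ≤ sum g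
∑-mono-≤ {zero}  f≤g = z≤n
∑-mono-≤ {suc n} f≤g = +-mono-≤ (f≤g zero) (∑-mono-≤ (f≤g ∘ suc))

∑-mono-< : ∀ {n} {f g : Fin n → ℕ} → (∀ i → f i ≤ g i) → ∀ j → f j < g j → sum f < sum g
∑-mono-< f≤g zero    fj<gj = +-mono-<-≤ fj<gj (∑-mono-≤ (f≤g ∘ suc))
∑-mono-< f≤g (suc j) fj<gj = +-mono-≤-< (f≤g zero) (∑-mono-< (f≤g ∘ suc) j fj<gj)

0<∑⇒ : ∀ {n} (f : Fin n → ℕ) → 0 < sum f → ∃[ i ] 0 < f i
0<∑⇒ {suc n} f 0<∑ with f zero in eq
... | suc _ = zero , subst (0 <_) (sym eq) z<s
... | zero  with 0<∑⇒ (f ∘ suc) 0<∑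
...   | i , 0<fi = suc i , 0<fi

∑-select : ∀ {n} (g : Fin n → ℕ) u → ∑[ v < n ] (g v * 𝟙 (u ≟ v)) ≡ g u
∑-select {suc n} g zero = begin
  g zero * 1 + ∑[ v < n ] (g (suc v) * 0)  ≡⟨ cong₂ _+_ (*-identityʳ (g zero)) (sum-cong-≗ (*-zeroʳ ∘ g ∘ suc)) ⟩
  g zero + ∑[ v < n ] 0                  ≡⟨ cong (g zero +_) (sum-replicate-zero n) ⟩
  g zero + 0                             ≡⟨ +-identityʳ (g zero) ⟩
  g zero                                 ∎
  where open ≡-Reasoning
∑-select {suc n} g (suc u) = cong₂ _+_ (*-zeroʳ (g zero)) (∑-select (g ∘ suc) u)

-- Grouping the hyperedges by their heads turns a count over hyperedges into one weighted by
-- in-degrees, so vertexwise comparisons of in-degrees carry over to `headsIn`.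
∑-fibres : ∀ {m n} (g : Fin n → ℕ) (h : Fin m → Fin n) →
           ∑[ e < m ] g (h e) ≡ ∑[ v < n ] (g v * ∑[ e < m ] 𝟙 (h e ≟ v))
∑-fibres {m} {n} g h = begin
  ∑[ e < m ] g (h e)                            ≡⟨ sum-cong-≗ (∑-select g ∘ h) ⟨
  ∑[ e < m ] ∑[ v < n ] (g v * 𝟙 (h e ≟ v))     ≡⟨ ∑-comm (λ e v → g v * 𝟙 (h e ≟ v)) ⟩
  ∑[ v < n ] ∑[ e < m ] (g v * 𝟙 (h e ≟ v))     ≡⟨ sum-cong-≗ (λ v → ∑-*ˡ (g v) (λ e → 𝟙 (h e ≟ v))) ⟩
  ∑[ v < n ] (g v * ∑[ e < m ] 𝟙 (h e ≟ v))     ∎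
  where
  open ≡-Reasoning
  ∑-*ˡ : ∀ {k} c (f : Fin k → ℕ) → ∑[ i < k ] (c * f i) ≡ c * sum f
  ∑-*ˡ {zero}  c f = sym (*-zeroʳ c)
  ∑-*ˡ {suc k} c f = trans (cong (c * f zero +_) (∑-*ˡ c (f ∘ suc))) (sym (*-distribˡ-+ c (f zero) _))

length-filter-tabulate : ∀ {A : Set} {P : A → Set} (P? : ∀ x → Dec (P x)) {n} (f : Fin n → A) →
                         length (filter P? (tabulate f)) ≡ ∑[ i < n ] 𝟙 (P? (f i))
length-filter-tabulate P? {zero}  f = refl
length-filter-tabulate P? {suc n} f with P? (f zero)
... | yes _ = cong suc (length-filter-tabulate P? (f ∘ suc))
... | no _  = length-filter-tabulate P? (f ∘ suc)

∑≡sum-allFin : ∀ {n} (f : Fin n → ℕ) → sum f ≡ ListAction.sum (map f (allFin n))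
∑≡sum-allFin f = trans (∑≡sum-tabulate f) (cong ListAction.sum (sym (map-tabulate id f)))
  where
  ∑≡sum-tabulate : ∀ {n} (f : Fin n → ℕ) → sum f ≡ ListAction.sum (tabulate f)
  ∑≡sum-tabulate {zero}  f = refl
  ∑≡sum-tabulate {suc n} f = cong (f zero +_) (∑≡sum-tabulate (f ∘ suc))

allFin-split : ∀ {n} {es : List (Fin n)} → Unique es → ∃[ rest ] allFin n ↭ es ++ rest
allFin-split {n} {[]}     _ = allFin n , ↭-refl
allFin-split {n} {e ∷ es} (e∉es ∷ uniq) with allFin-split uniq
... | rest , p with ∈-++⁻ es (∈-resp-↭ p (∈-allFin e))
...   | inj₁ e∈es = contradiction refl (All.lookup e∉es e∈es)
...   | inj₂ e∈rest with ∈-∃++ e∈rest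
...     | xs , ys , refl =
  xs ++ ys , ↭-trans p (↭-trans (++⁺ˡ es (shift e xs ys)) (shift e es (xs ++ ys)))

Unique-++⇒disjoint : ∀ {A : Set} (xs : List A) {ys : List A} → Unique (xs ++ ys) → All (List._∉ xs) ys
Unique-++⇒disjoint []       _ = All.tabulate (λ _ ())
Unique-++⇒disjoint (x ∷ xs) (x∉ ∷ uniq) = All.tabulate λ
  { y∈ys (here refl)  → All.lookup x∉ (∈-++⁺ʳ xs y∈ys) refl
  ; y∈ys (there y∈xs) → All.lookup (Unique-++⇒disjoint xs uniq) y∈ys y∈xs }

-- Walks

-- Walks run through hyperedge indices rather than hyperarcs, which keeps parallel hyperedges apart.
-- `T e u` says that a walk may enter `e` at `u`; it leaves at `h e`. Path reversal takes `T` to be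
-- membership in the tail; cycle reversal admits only the desired head of a misoriented hyperedge.
module Walks {m n : ℕ} (h : Fin m → Fin n) (T : Fin m → Fin n → Set) where

  infixr 5 _∷_

  data Walk : Fin n → List (Fin m) → Fin n → Set where
    []  : ∀ {s} → Walk s [] s
    _∷_ : ∀ {s e es t} → T e s → Walk (h e) es t → Walk s (e ∷ es) t

  snoc : ∀ {s es u e} → Walk s es u → T e u → ∃[ es′ ] Walk s es′ (h e)
  snoc []      Teu = _ , Teu ∷ []
  snoc (x ∷ w) Teu = _ , x ∷ proj₂ (snoc w Teu)

  suffixAfter : ∀ {s es t v} → Walk s es t → Unique (map h es) → v List.∈ map h es →
                ∃[ es′ ] Walk v es′ t × Unique (v ∷ map h es′)
  suffixAfter (_ ∷ w) uniq       (here refl) = _ , w , uniq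
  suffixAfter (_ ∷ w) (_ ∷ uniq) (there v∈)  = suffixAfter w uniq v∈

  -- If `h e` recurs as a later head, continue directly from that occurrence. The first hyperedge
  -- survives, so the cycle argument can prescribe one hyperedge to be reversed. Only heads become
  -- distinct, so `s` may equal `t`.
  shorten : ∀ {s e es t} → Walk s (e ∷ es) t →
            ∃[ es′ ] Walk s (e ∷ es′) t × Unique (map h (e ∷ es′))
  shorten (Tes ∷ []) = [] , Tes ∷ [] , [] ∷ []
  shorten {e = e} (Tes ∷ w@(_ ∷ _)) with shorten w
  ... | es′ , w′ , uniq with ∈-dec _≟_ (h e) (map h (_ ∷ es′))
  ...   | no he∉  = _ , Tes ∷ w′ , ¬Any⇒All¬ _ he∉ ∷ uniq
  ...   | yes he∈ with suffixAfter w′ uniq he∈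
  ...     | _ , w″ , uniq″ = _ , Tes ∷ w″ , uniq″

  Closed : Subset n → Set
  Closed X = ∀ {e u} → u ∈ X → T e u → h e ∈ X

  -- Grow the set of vertices reached from `s` along hyperedges that exit it. Once none is left the
  -- set is closed, and it either contains `t` or separates `t` from `s`.
  reach : (∀ e u → Dec (T e u)) → ∀ s t →
          (∃[ es ] Walk s es t) ⊎ (∃[ X ] s ∈ X × t ∉ X × Closed X)
  reach T? s t = grow ⁅ s ⁆ (⊃-wellFounded _) (x∈⁅x⁆ s)
                   λ v∈ → [] , subst (Walk s []) (sym (x∈⁅y⁆⇒x≡y s v∈)) []
    where
    grow : ∀ X → Acc _⊃_ X → s ∈ X → (∀ {v} → v ∈ X → ∃[ es ] Walk s es v) →
           (∃[ es ] Walk s es t) ⊎ (∃[ X ] s ∈ X × t ∉ X × Closed X)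
    grow X (acc rec) s∈X walkTo
      with any? (λ e → any? λ u → (u ∈? X) ×-dec T? e u ×-dec ¬? (h e ∈? X))
    ... | yes (e , u , u∈X , Teu , he∉X) =
      grow (X ∪ ⁅ h e ⁆)
           (rec (p⊆p∪q _ , h e , q⊆p∪q X _ (x∈⁅x⁆ (h e)) , he∉X))
           (p⊆p∪q _ s∈X)
           ([ walkTo , (λ v∈ → subst (λ v → ∃[ es ] Walk s es v) (sym (x∈⁅y⁆⇒x≡y _ v∈))
                                     (snoc (proj₂ (walkTo u∈X)) Teu)) ]′ ∘ x∈p∪q⁻ X _)
    ... | no ¬exit with t ∈? X
    ...   | yes t∈X = inj₁ (walkTo t∈X)
    ...   | no t∉X  = inj₂ (X , s∈X , t∉X , closed)
      where
      closed : Closed X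
      closed {e} {u} u∈X Teu with h e ∈? X
      ... | yes he∈X = he∈X
      ... | no he∉X  = contradiction (e , u , u∈X , Teu , he∉X) ¬exit

  -- The heads after reversing a walk es from s: the i-th step now points to the
  -- head of the previous one, the first step to s.
  newHead : Fin n → List (Fin m) → Fin m → Fin n
  newHead s []       x = h x
  newHead s (e ∷ es) x with x ≟ e
  ... | yes _ = s
  ... | no _  = newHead (h e) es x

  newHead-here : ∀ s e es → newHead s (e ∷ es) e ≡ s
  newHead-here s e es with e ≟ e
  ... | yes _  = refl
  ... | no e≢e = contradiction refl e≢e

  newHead-∉ : ∀ s es {x} → x List.∉ es → newHead s es x ≡ h x
  newHead-∉ s []       _ = refl
  newHead-∉ s (e ∷ es) {x} x∉ with x ≟ e
  ... | yes x≡e = contradiction (here x≡e) x∉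
  ... | no _    = newHead-∉ (h e) es (x∉ ∘ there)

  -- A reversed hyperedge now points to the vertex at which the walk entered it. Hence the new head
  -- lies in the hyperedge, and in the cycle argument it is the desired one.
  newHead-case : ∀ {s es t} → Walk s es t → ∀ x → newHead s es x ≡ h x ⊎ T x (newHead s es x)
  newHead-case [] x = inj₁ refl
  newHead-case {es = e ∷ _} (Tes ∷ w) x with x ≟ e
  ... | yes refl = inj₂ Tes
  ... | no _     = newHead-case w x

  module _ {A : Set} (F : Fin m → Fin n → A) where

    map-newHead-∉ : ∀ s es {xs} → All (List._∉ es) xs →
                    map (λ x → F x (newHead s es x)) xs ≡ map (λ x → F x (h x)) xs
    map-newHead-∉ s es []        = refl
    map-newHead-∉ s es (x∉ ∷ p) = cong₂ _∷_ (cong (F _) (newHead-∉ s es x∉)) (map-newHead-∉ s es p)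

    map-newHead-∷ : ∀ s e es {xs} → All (e ≢_) xs →
                    map (λ x → F x (newHead s (e ∷ es) x)) xs ≡ map (λ x → F x (newHead (h e) es x)) xs
    map-newHead-∷ s e es []                = refl
    map-newHead-∷ s e es {x ∷ _} (e≢x ∷ p) with x ≟ e
    ... | yes x≡e = contradiction (sym x≡e) e≢x
    ... | no _    = cong₂ _∷_ refl (map-newHead-∷ s e es p)

  -- Telescoping: each head on the walk is replaced by the preceding one, so only the weights of the
  -- two ends survive.
  sum-newHead : (g : Fin n → ℕ) → ∀ {s es t} → Walk s es t → Unique es →
                ListAction.sum (map (g ∘ newHead s es) es) + g t ≡ ListAction.sum (map (g ∘ h) es) + g s
  sum-newHead g [] _ = refl
  sum-newHead g {s} {e ∷ es} {t} (_ ∷ w) (e∉es ∷ uniq)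
    rewrite newHead-here s e es | map-newHead-∷ (λ _ → g) s e es e∉es = begin
      g s + new + g t        ≡⟨ +-assoc (g s) new (g t) ⟩
      g s + (new + g t)      ≡⟨ cong (g s +_) (sum-newHead g w uniq) ⟩
      g s + (old + g (h e))  ≡⟨ +-comm (g s) _ ⟩
      old + g (h e) + g s    ≡⟨ cong (_+ g s) (+-comm old (g (h e))) ⟩
      g (h e) + old + g s    ∎
    where
    open ≡-Reasoning
    new = ListAction.sum (map (g ∘ newHead (h e) es) es)
    old = ListAction.sum (map (g ∘ h) es)

  -- Heads off the walk do not change. With `g` the indicator of a vertex or of a set, this is the
  -- effect of a reversal on `inDegree` or `headsIn`.
  ∑-newHead : (g : Fin n → ℕ) → ∀ {s es t} → Walk s es t → Unique es →
              ∑[ x < m ] g (newHead s es x) + g t ≡ ∑[ x < m ] g (h x) + g s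
  ∑-newHead g {s} {es} {t} w uniq with allFin-split uniq
  ... | rest , p = begin
    sum (g ∘ newHead s es) + g t                     ≡⟨ cong (_+ g t) (split (g ∘ newHead s es)) ⟩
    S (g ∘ newHead s es) es + S (g ∘ newHead s es) rest + g t
                                                     ≡⟨ cong (λ z → S (g ∘ newHead s es) es + z + g t)
                                                         (cong ListAction.sum (map-newHead-∉ (λ _ → g) s es disj)) ⟩
    S (g ∘ newHead s es) es + S (g ∘ h) rest + g t   ≡⟨ swapʳ (S (g ∘ newHead s es) es) _ _ ⟩
    S (g ∘ newHead s es) es + g t + S (g ∘ h) rest   ≡⟨ cong (_+ S (g ∘ h) rest) (sum-newHead g w uniq) ⟩
    S (g ∘ h) es + g s + S (g ∘ h) rest              ≡⟨ swapʳ (S (g ∘ h) es) _ _ ⟩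
    S (g ∘ h) es + S (g ∘ h) rest + g s              ≡⟨ cong (_+ g s) (split (g ∘ h)) ⟨
    sum (g ∘ h) + g s                                ∎
    where
    open ≡-Reasoning
    S : (Fin m → ℕ) → List (Fin m) → ℕ
    S f xs = ListAction.sum (map f xs)
    swapʳ : ∀ a b c → a + b + c ≡ a + c + b
    swapʳ a b c = trans (+-assoc a b c) (trans (cong (a +_) (+-comm b c)) (sym (+-assoc a c b)))
    disj : All (List._∉ es) rest
    disj = Unique-++⇒disjoint es (Unique-resp-↭ (setoid _) (↭⇒↭ₛ p) (allFin⁺ m))
    split : ∀ f → sum f ≡ S f es + S f rest
    split f = trans (∑≡sum-allFin f) (trans (sum-↭ (map⁺ f p))
                (trans (cong ListAction.sum (map-++ f es rest)) (sum-++ (map f es) _)))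

-- Reversing a hyperpath

x∉p-x : ∀ {n} (x : Fin n) (p : Subset n) → x ∉ p - x
x∉p-x zero    (_ ∷ _) ()
x∉p-x (suc x) (_ ∷ p) (there x∈) = x∉p-x x p x∈

x∈p-y⇒x∈p : ∀ {n} {x y : Fin n} {p : Subset n} → x ∈ p - y → x ∈ p
x∈p-y⇒x∈p {y = y} {p} = p─q⊆p p ⁅ y ⁆

x∈p-y⇒x≢y : ∀ {n} {x y : Fin n} {p : Subset n} → x ∈ p - y → x ≢ y
x∈p-y⇒x≢y {x = x} {p = p} x∈ refl = x∉p-x x p x∈

-- Reconciles the tail prescribed by `reversed` with the one obtained by orienting the hyperedge
-- anew: `v` returns to the tail, and it differs from `s` because `s` was in the old tail.
reversed-tail : ∀ {n} {Z : Subset n} {v s : Fin n} → v ∈ Z → s ∈ Z - v → ((Z - v) - s) ∪ ⁅ v ⁆ ≡ Z - s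
reversed-tail {Z = Z} {v} {s} v∈Z s∈Z-v = ⊆-antisym
  ([ (λ x∈ → x∈p∧x≢y⇒x∈p-y (x∈p-y⇒x∈p (x∈p-y⇒x∈p x∈)) (x∈p-y⇒x≢y x∈))
   , (λ x∈ → subst (_∈ Z - s) (sym (x∈⁅y⁆⇒x≡y v x∈)) (x∈p∧x≢y⇒x∈p-y v∈Z (x∈p-y⇒x≢y s∈Z-v ∘ sym))) ]′
   ∘ x∈p∪q⁻ ((Z - v) - s) ⁅ v ⁆)
  back
  where
  back : ∀ {x} → x ∈ Z - s → x ∈ ((Z - v) - s) ∪ ⁅ v ⁆
  back {x} x∈ with x ≟ v
  ... | yes refl = q⊆p∪q _ _ (x∈⁅x⁆ v)
  ... | no x≢v   = p⊆p∪q _ (x∈p∧x≢y⇒x∈p-y (x∈p∧x≢y⇒x∈p-y (x∈p-y⇒x∈p x∈) x≢v) (x∈p-y⇒x≢y x∈))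

arc : ∀ {H} → Orientation H → Fin (#E H) → Hyperarc (#V H)
arc {H} O e = orient (edge H e) (headOf O e)

module Reversal {H : Hypergraph} (O : Orientation H) {T : Fin (#E H) → Fin (#V H) → Set}
                (T⇒tail : ∀ {e u} → T e u → u ∈ edge H e - headOf O e) where

  open Walks (headOf O) T

  Walk⇒Chain : ∀ {s e es t} → Walk s (e ∷ es) t → Chain s (map (arc O) (e ∷ es)) t
  Walk⇒Chain (Tes ∷ [])         = last (T⇒tail Tes)
  Walk⇒Chain (Tes ∷ w@(_ ∷ _)) = step (T⇒tail Tes) (Walk⇒Chain w)

  newArcs≡reversed : ∀ {s es t} → Walk s es t → Unique es →
                     map (λ x → orient (edge H x) (newHead s es x)) es ≡ reversed s (map (arc O) es)
  newArcs≡reversed [] _ = refl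
  newArcs≡reversed {s} {e ∷ es} (Tes ∷ w) (e∉es ∷ uniq) = cong₂ _∷_
    (trans (cong (orient (edge H e)) (newHead-here s e es))
           (cong (_⇒ s) (sym (reversed-tail (headOf∈ O e) (T⇒tail Tes)))))
    (trans (map-newHead-∷ (λ x → orient (edge H x)) s e es e∉es) (newArcs≡reversed w uniq))

  reverse : ∀ {s es t} → Walk s es t → Orientation H
  reverse {s} {es} w = record { headOf = newHead s es ; headOf∈ = newHead∈ }
    where
    newHead∈ : ∀ e → newHead s es e ∈ edge H e
    newHead∈ e with newHead-case w e
    ... | inj₁ eq = subst (_∈ edge H e) (sym eq) (headOf∈ O e)
    ... | inj₂ Te = x∈p-y⇒x∈p (T⇒tail Te)

  reverse-arises : ∀ {s e es t} (w : Walk s (e ∷ es) t) → Unique (map (headOf O) (e ∷ es)) →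
                   ArisesByReversal O (reverse w)
  reverse-arises {s} {e} {es′} {t} w uniqHeads =
    s , t , map (arc O) es , map (arc O) rest , path , split (arc O) , newSplit
    where
    es = e ∷ es′
    -- Distinct heads force distinct hyperedges, so those of the walk can be split off from the list
    -- of all hyperedges.
    uniq : Unique es
    uniq = Unique.map⁻ uniqHeads
    rest = proj₁ (allFin-split uniq)
    p : allFin (#E H) ↭ es ++ rest
    p = proj₂ (allFin-split uniq)
    split : ∀ {A : Set} (f : Fin (#E H) → A) → tabulate f ↭ map f es ++ map f rest
    split f = ↭-trans (↭-reflexive (sym (map-tabulate id f)))
                (↭-trans (map⁺ f p) (↭-reflexive (map-++ f es rest)))
    newArc : Fin (#E H) → Hyperarc (#V H)
    newArc x = orient (edge H x) (newHead s es x)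
    newSplit : tabulate newArc ↭ reversed s (map (arc O) es) ++ map (arc O) rest
    newSplit = ↭-trans (split newArc) (↭-reflexive (cong₂ _++_
      (newArcs≡reversed w uniq)
      (map-newHead-∉ (λ x → orient (edge H x)) s es
        (Unique-++⇒disjoint es (Unique-resp-↭ (setoid _) (↭⇒↭ₛ p) (allFin⁺ _))))))
    path : IsHyperpath O s t (map (arc O) es)
    path = record
      { chain         = Walk⇒Chain w
      ; distinctHeads = subst Unique (map-∘ es) uniqHeads
      ; inOrientation = All.tabulate (∈-resp-↭ (↭-sym (split (arc O))) ∘ ∈-++⁺ˡ)
      }

-- Degrees

module _ {H : Hypergraph} where

  headsIn : Orientation H → Subset (#V H) → ℕ
  headsIn O X = ∑[ e < #E H ] 𝟙 (headOf O e ∈? X)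

  inDegree : Orientation H → Fin (#V H) → ℕ
  inDegree O v = ∑[ e < #E H ] 𝟙 (headOf O e ≟ v)

  headsIn≡∑inDegree : ∀ O X → headsIn O X ≡ ∑[ v < #V H ] (𝟙 (v ∈? X) * inDegree O v)
  headsIn≡∑inDegree O X = ∑-fibres (λ v → 𝟙 (v ∈? X)) (headOf O)

  d⁺≡∑ : ∀ (O : Orientation H) X → d⁺ O X ≡ ∑[ e < #E H ] 𝟙 (leaves? X (arc O e))
  d⁺≡∑ O X = length-filter-tabulate (leaves? X) (arc O)

-- A hyperedge meeting `X` either has its head in `X` or leaves `X`, never both. The right-hand side
-- does not mention `v`, which makes `d⁺` plus `headsIn` independent of the orientation.
leaves+head∈ : ∀ {n} {Z : Subset n} {v} X → v ∈ Z →
               𝟙 (leaves? X (orient Z v)) + 𝟙 (v ∈? X) ≡ 𝟙 (nonempty? (Z ∩ X))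
leaves+head∈ {Z = Z} {v} X v∈Z with v ∈? X
... | yes v∈X = sym (𝟙-yes (nonempty? (Z ∩ X)) (v , x∈p∩q⁺ (v∈Z , v∈X)))
... | no v∉X  = trans (+-identityʳ _) (𝟙-cong (nonempty? ((Z - v) ∩ X)) (nonempty? (Z ∩ X)) weaken strengthen)
  where
  weaken : Nonempty ((Z - v) ∩ X) → Nonempty (Z ∩ X)
  weaken (x , x∈) with x∈p∩q⁻ (Z - v) X x∈
  ... | x∈Z-v , x∈X = x , x∈p∩q⁺ (x∈p-y⇒x∈p x∈Z-v , x∈X)
  strengthen : Nonempty (Z ∩ X) → Nonempty ((Z - v) ∩ X)
  strengthen (x , x∈) with x∈p∩q⁻ Z X x∈
  ... | x∈Z , x∈X = x , x∈p∩q⁺ (x∈p∧x≢y⇒x∈p-y x∈Z (λ { refl → v∉X x∈X }) , x∈X)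

-- A tail meeting `X ∩ Y` meets both sets, and a head outside `X ∪ Y` is outside both; leaving
-- either combination therefore means leaving `X` or `Y`, and leaving both combinations means
-- leaving both.
leaves-submodular : ∀ {n} (X Y : Subset n) a →
                    𝟙 (leaves? (X ∩ Y) a) + 𝟙 (leaves? (X ∪ Y) a) ≤ 𝟙 (leaves? X a) + 𝟙 (leaves? Y a)
leaves-submodular X Y a@(A ⇒ v) =
  𝟙-submodular (leaves? (X ∩ Y) a) (leaves? (X ∪ Y) a) (leaves? X a) (leaves? Y a) ∩⇒ ∪⇒ both
  where
  ∩⇒both : Nonempty (A ∩ (X ∩ Y)) → Nonempty (A ∩ X) × Nonempty (A ∩ Y)
  ∩⇒both (x , x∈) with x∈p∩q⁻ A (X ∩ Y) x∈
  ... | x∈A , x∈XY with x∈p∩q⁻ X Y x∈XY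
  ...   | x∈X , x∈Y = (x , x∈p∩q⁺ (x∈A , x∈X)) , (x , x∈p∩q⁺ (x∈A , x∈Y))
  ∩⇒ : Leaves (X ∩ Y) a → Leaves X a ⊎ Leaves Y a
  ∩⇒ (v∉ , ne) with v ∈? X
  ... | no v∉X  = inj₁ (v∉X , proj₁ (∩⇒both ne))
  ... | yes v∈X = inj₂ ((λ v∈Y → v∉ (x∈p∩q⁺ (v∈X , v∈Y))) , proj₂ (∩⇒both ne))
  ∪⇒ : Leaves (X ∪ Y) a → Leaves X a ⊎ Leaves Y a
  ∪⇒ (v∉ , x , x∈) with x∈p∩q⁻ A (X ∪ Y) x∈
  ... | x∈A , x∈XY with x∈p∪q⁻ X Y x∈XY
  ...   | inj₁ x∈X = inj₁ (v∉ ∘ p⊆p∪q Y , x , x∈p∩q⁺ (x∈A , x∈X))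
  ...   | inj₂ x∈Y = inj₂ (v∉ ∘ q⊆p∪q X Y , x , x∈p∩q⁺ (x∈A , x∈Y))
  both : Leaves (X ∩ Y) a → Leaves (X ∪ Y) a → Leaves X a × Leaves Y a
  both (_ , ne) (v∉ , _) =
    (v∉ ∘ p⊆p∪q Y , proj₁ (∩⇒both ne)) , (v∉ ∘ q⊆p∪q X Y , proj₂ (∩⇒both ne))

module _ {H : Hypergraph} where

  d⁺+headsIn : ∀ (O : Orientation H) X → d⁺ O X + headsIn O X ≡ ∑[ e < #E H ] 𝟙 (nonempty? (edge H e ∩ X))
  d⁺+headsIn O X = begin
    d⁺ O X + headsIn O X                                                ≡⟨ cong (_+ headsIn O X) (d⁺≡∑ O X) ⟩
    sum leaving + headsIn O X                                           ≡⟨ ∑-distrib-+ leaving (λ e → 𝟙 (headOf O e ∈? X)) ⟨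
    ∑[ e < #E H ] (leaving e + 𝟙 (headOf O e ∈? X))                     ≡⟨ sum-cong-≗ (λ e → leaves+head∈ X (headOf∈ O e)) ⟩
    ∑[ e < #E H ] 𝟙 (nonempty? (edge H e ∩ X))                          ∎
    where
    open ≡-Reasoning
    leaving : Fin (#E H) → ℕ
    leaving e = 𝟙 (leaves? X (arc O e))

  d⁺+headsIn-invariant : ∀ (O O′ : Orientation H) X → d⁺ O X + headsIn O X ≡ d⁺ O′ X + headsIn O′ X
  d⁺+headsIn-invariant O O′ X = trans (d⁺+headsIn O X) (sym (d⁺+headsIn O′ X))

  d⁺-submodular : ∀ (O : Orientation H) X Y → d⁺ O (X ∩ Y) + d⁺ O (X ∪ Y) ≤ d⁺ O X + d⁺ O Y
  d⁺-submodular O X Y = begin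
    d⁺ O (X ∩ Y) + d⁺ O (X ∪ Y)                          ≡⟨ cong₂ _+_ (d⁺≡∑ O (X ∩ Y)) (d⁺≡∑ O (X ∪ Y)) ⟩
    sum (leaving (X ∩ Y)) + sum (leaving (X ∪ Y))        ≡⟨ ∑-distrib-+ (leaving (X ∩ Y)) (leaving (X ∪ Y)) ⟨
    ∑[ e < #E H ] (leaving (X ∩ Y) e + leaving (X ∪ Y) e) ≤⟨ ∑-mono-≤ (λ e → leaves-submodular X Y (arc O e)) ⟩
    ∑[ e < #E H ] (leaving X e + leaving Y e)            ≡⟨ ∑-distrib-+ (leaving X) (leaving Y) ⟩
    sum (leaving X) + sum (leaving Y)                    ≡⟨ cong₂ _+_ (d⁺≡∑ O X) (d⁺≡∑ O Y) ⟨
    d⁺ O X + d⁺ O Y                                      ∎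
    where
    open ≤-Reasoning
    leaving : Subset (#V H) → Fin (#E H) → ℕ
    leaving X e = 𝟙 (leaves? X (arc O e))

  headsIn-∪ : ∀ (O : Orientation H) X Y → (∀ {v} → v ∈ X → v ∉ Y) → headsIn O (X ∪ Y) ≡ headsIn O X + headsIn O Y
  headsIn-∪ O X Y disj = trans (sum-cong-≗ (pointwise ∘ headOf O)) (∑-distrib-+ (λ e → 𝟙 (headOf O e ∈? X)) _)
    where
    pointwise : ∀ v → 𝟙 (v ∈? X ∪ Y) ≡ 𝟙 (v ∈? X) + 𝟙 (v ∈? Y)
    pointwise v with v ∈? X | v ∈? Y
    ... | yes v∈X | yes v∈Y = contradiction v∈Y (disj v∈X)
    ... | yes v∈X | no _    = 𝟙-yes (v ∈? X ∪ Y) (p⊆p∪q Y v∈X)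
    ... | no _    | yes v∈Y = 𝟙-yes (v ∈? X ∪ Y) (q⊆p∪q X Y v∈Y)
    ... | no v∉X  | no v∉Y  = 𝟙-no (v ∈? X ∪ Y) ([ v∉X , v∉Y ]′ ∘ x∈p∪q⁻ X Y)

  module _ (O O′ : Orientation H) X (le : ∀ {v} → v ∈ X → inDegree O v ≤ inDegree O′ v) where

    private
      term-mono : ∀ v → 𝟙 (v ∈? X) * inDegree O v ≤ 𝟙 (v ∈? X) * inDegree O′ v
      term-mono v with v ∈? X
      ... | yes v∈X = *-monoʳ-≤ 1 (le v∈X)
      ... | no _    = z≤n

    headsIn-mono-≤ : headsIn O X ≤ headsIn O′ X
    headsIn-mono-≤ rewrite headsIn≡∑inDegree O X | headsIn≡∑inDegree O′ X = ∑-mono-≤ term-mono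

    headsIn-mono-< : ∀ {t} → t ∈ X → inDegree O t < inDegree O′ t → headsIn O X < headsIn O′ X
    headsIn-mono-< {t} t∈X lt rewrite headsIn≡∑inDegree O X | headsIn≡∑inDegree O′ X =
      ∑-mono-< term-mono t term-mono-<
      where
      term-mono-< : 𝟙 (t ∈? X) * inDegree O t < 𝟙 (t ∈? X) * inDegree O′ t
      term-mono-< with t ∈? X
      ... | yes _  = *-monoʳ-< 1 lt
      ... | no t∉X = contradiction t∈X t∉X

-- The exchange property

module Exchange {k : ℕ} {H : Hypergraph} (O O′ : Orientation H)
                (conn : k -HyperarcConnected O) (conn′ : k -HyperarcConnected O′) (t : Fin (#V H)) where

  -- Avoiding `t` makes `C` proper, so connectivity supplies `k ≤ d⁺ O C` and the bound here amounts
  -- to equality.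
  Tight : Subset (#V H) → Set
  Tight C = Nonempty C × t ∉ C × d⁺ O C ≤ k

  proper : ∀ {C} → t ∉ C → C ⊂ ⊤
  proper t∉C = (λ _ → ∈⊤) , t , ∈⊤ , t∉C

  -- Uncrossing: `C ∩ D` is nonempty and avoids `t`, so it takes at least `k` of the total `k + k`
  -- allowed by submodularity.
  tight-∪ : ∀ {C D} → Tight C → Tight D → Nonempty (C ∩ D) → Tight (C ∪ D)
  tight-∪ {C} {D} ((c , c∈C) , t∉C , dC≤k) (_ , t∉D , dD≤k) C∩D≢∅ =
    (c , p⊆p∪q D c∈C) , [ t∉C , t∉D ]′ ∘ x∈p∪q⁻ C D , +-cancelˡ-≤ k _ _ (begin
      k + d⁺ O (C ∪ D)             ≤⟨ +-monoˡ-≤ _ (conn (C ∩ D) C∩D≢∅ (proper (t∉C ∘ proj₁ ∘ x∈p∩q⁻ C D))) ⟩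
      d⁺ O (C ∩ D) + d⁺ O (C ∪ D)  ≤⟨ d⁺-submodular O C D ⟩
      d⁺ O C + d⁺ O D              ≤⟨ +-mono-≤ dC≤k dD≤k ⟩
      k + k                        ∎)
    where open ≤-Reasoning

  -- The sum of `d⁺` and `headsIn` is the same for both orientations, while `d⁺ O C ≤ k ≤ d⁺ O′ C`.
  tight-headsIn : ∀ {C} → Tight C → headsIn O′ C ≤ headsIn O C
  tight-headsIn {C} (C≢∅ , t∉C , dC≤k) = +-cancelˡ-≤ (d⁺ O′ C) _ _ (begin
    d⁺ O′ C + headsIn O′ C  ≡⟨ d⁺+headsIn-invariant O′ O C ⟩
    d⁺ O C + headsIn O C    ≤⟨ +-monoˡ-≤ _ (≤-trans dC≤k (conn′ C C≢∅ (proper t∉C))) ⟩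
    d⁺ O′ C + headsIn O C   ∎)
    where open ≤-Reasoning

  -- A family of pairwise disjoint tight sets, indexed by its union; disjointness lets `headsIn` be
  -- added up over the members.
  data TightUnion : Subset (#V H) → Set where
    empty : TightUnion ⊥
    join  : ∀ {C U} → Tight C → (∀ {v} → v ∈ C → v ∉ U) → TightUnion U → TightUnion (C ∪ U)

  insert : ∀ {C U} → Tight C → TightUnion U → TightUnion (C ∪ U)
  insert tC empty = join tC (λ _ → ∉⊥) empty
  insert {C} tC (join {D} {U} tD D∩U=∅ tU) with nonempty? (C ∩ D)
  -- The merged set may meet further members, so it is inserted again into the remaining family.
  ... | yes C∩D≢∅ = subst TightUnion (∪-assoc C D U) (insert (tight-∪ tC tD C∩D≢∅) tU)
  ... | no C∩D=∅  = subst TightUnion D∪[C∪U]≡C∪[D∪U] (join tD disjoint (insert tC tU))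
    where
    disjoint : ∀ {v} → v ∈ D → v ∉ C ∪ U
    disjoint v∈D = [ (λ v∈C → C∩D=∅ (_ , x∈p∩q⁺ (v∈C , v∈D))) , D∩U=∅ v∈D ]′ ∘ x∈p∪q⁻ C U
    D∪[C∪U]≡C∪[D∪U] : D ∪ (C ∪ U) ≡ C ∪ (D ∪ U)
    D∪[C∪U]≡C∪[D∪U] = trans (sym (∪-assoc D C U)) (trans (cong (_∪ U) (∪-comm D C)) (∪-assoc C D U))

  t∉TightUnion : ∀ {U} → TightUnion U → t ∉ U
  t∉TightUnion empty = ∉⊥
  t∉TightUnion (join {C} {U} (_ , t∉C , _) _ tU) = [ t∉C , t∉TightUnion tU ]′ ∘ x∈p∪q⁻ C U

  TightUnion-headsIn : ∀ {U} → TightUnion U → headsIn O′ U ≤ headsIn O U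
  TightUnion-headsIn empty = headsIn-mono-≤ O′ O ⊥ (λ v∈⊥ → contradiction v∈⊥ ∉⊥)
  TightUnion-headsIn (join {C} {U} tC disj tU)
    rewrite headsIn-∪ O′ C U disj | headsIn-∪ O C U disj = +-mono-≤ (tight-headsIn tC) (TightUnion-headsIn tU)

  -- The second condition is the slack for a reversal from `s` to `t`: exactly the sets containing
  -- `s` but not `t` lose a unit of out-degree.
  Augmentable : Fin (#V H) → Set
  Augmentable s = inDegree O s < inDegree O′ s × (∀ C → s ∈ C → t ∉ C → k < d⁺ O C)

  -- A deficient vertex that is not augmentable lies in a tight set, which is merged into the
  -- family; if no augmentable vertex turns up, the family covers all deficient vertices of `vs`.
  search : ∀ vs → ∃ Augmentable ⊎
           ∃[ U ] TightUnion U × All (λ s → inDegree O s < inDegree O′ s → s ∈ U) vs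
  search [] = inj₂ (⊥ , empty , [])
  search (s ∷ vs) with search vs
  ... | inj₁ found = inj₁ found
  ... | inj₂ (U , tU , cover) with inDegree O s <? inDegree O′ s
  ...   | no ≮  = inj₂ (U , tU , (λ lt → contradiction lt ≮) ∷ cover)
  ...   | yes lt with anySubset? (λ C → (s ∈? C) ×-dec ¬? (t ∈? C) ×-dec (d⁺ O C ≤? k))
  ...     | yes (C , s∈C , t∉C , dC≤k) =
    inj₂ (C ∪ U , insert ((s , s∈C) , t∉C , dC≤k) tU ,
          (λ _ → p⊆p∪q U s∈C) ∷ All.map (λ s∈U → q⊆p∪q C U ∘ s∈U) cover)
  ...     | no ¬tight = inj₁ (s , lt , λ C s∈C t∉C → ≰⇒> (λ dC≤k → ¬tight (C , s∈C , t∉C , dC≤k)))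

  -- Each head lies in exactly one of `U` and its complement, so either side counts all hyperedges.
  headsIn-total : ∀ U → headsIn O U + headsIn O (∁ U) ≡ headsIn O′ U + headsIn O′ (∁ U)
  headsIn-total U = begin
    headsIn O U + headsIn O (∁ U)    ≡⟨ headsIn-∪ O U (∁ U) x∈p⇒x∉∁p ⟨
    headsIn O (U ∪ ∁ U)              ≡⟨ sum-cong-≗ (λ e → trans (everywhere (headOf O e)) (sym (everywhere (headOf O′ e)))) ⟩
    headsIn O′ (U ∪ ∁ U)             ≡⟨ headsIn-∪ O′ U (∁ U) x∈p⇒x∉∁p ⟩
    headsIn O′ U + headsIn O′ (∁ U)  ∎
    where
    open ≡-Reasoning
    everywhere : ∀ v → 𝟙 (v ∈? U ∪ ∁ U) ≡ 1
    everywhere v = 𝟙-yes (v ∈? U ∪ ∁ U) (subst (v ∈_) (sym (∪-inverseʳ U)) ∈⊤)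

  exchange : inDegree O′ t < inDegree O t → ∃ Augmentable
  exchange lt with search (allFin (#V H))
  ... | inj₁ found = found
  -- Inside `U` the orientation `O` has at least as many heads as `O′`; outside `U` no vertex is
  -- deficient and `t` has a surplus, so the totals would differ.
  ... | inj₂ (U , tU , cover) = contradiction (headsIn-total U) (>⇒≢ (+-mono-≤-< (TightUnion-headsIn tU)
    (headsIn-mono-< O′ O (∁ U)
      (λ {v} v∈∁U → ≮⇒≥ (x∈∁p⇒x∉p v∈∁U ∘ All.lookup cover (∈-allFin v)))
      (x∉p⇒x∈∁p (t∉TightUnion tU)) lt)))

-- Reconfiguration

module _ {k : ℕ} {H : Hypergraph} where

  stop : ∀ {O O′ : Orientation H} → k -HyperarcConnected O → headOf O ≗ headOf O′ → ReversalSequence k O O′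
  stop {O} conn eq = record
    { ℓ         = 0
    ; term      = λ _ → O
    ; first     = ↭-refl
    ; final     = ↭-reflexive (tabulate-cong (λ e → cong (orient (edge H e)) (eq e)))
    ; connected = λ _ → conn
    ; reversal  = λ ()
    }

  infixr 5 _,_◅_

  _,_◅_ : ∀ {O O₁ O′ : Orientation H} → k -HyperarcConnected O → ArisesByReversal O O₁ →
          ReversalSequence k O₁ O′ → ReversalSequence k O O′
  _,_◅_ {O} {O₁} {O′} conn (s , t , P , R , path , p , p₁) seq = record
    { ℓ         = suc ℓ
    ; term      = λ { zero → O ; (suc i) → term i }
    ; first     = ↭-refl
    ; final     = final
    ; connected = λ { zero → conn ; (suc i) → connected i }
    -- The tail sequence starts at an orientation that is only `≈` to `O₁`, so the multiset equation
    -- for `O₁` is transported along `first`.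
    ; reversal  = λ { zero → s , t , P , R , path , p , ↭-trans first p₁ ; (suc i) → reversal i }
    }
    where open ReversalSequence seq

-- The potential for the path phase. Truncated subtraction records surpluses only, so it vanishes
-- exactly when no in-degree exceeds its target.
excess : ∀ {H} → Orientation H → Orientation H → ℕ
excess {H} O O′ = ∑[ v < #V H ] (inDegree O v ∸ inDegree O′ v)

mismatches : ∀ {H} → Orientation H → Orientation H → ℕ
mismatches {H} O O′ = ∑[ e < #E H ] 𝟙 (¬? (headOf O e ≟ headOf O′ e))

module _ {H : Hypergraph} (O : Orientation H) {T : Fin (#E H) → Fin (#V H) → Set}
         (T⇒tail : ∀ {e u} → T e u → u ∈ edge H e - headOf O e) where

  open Walks (headOf O) T
  open Reversal O T⇒tail

  module _ {s es t} (w : Walk s es t) (uniq : Unique es) where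

    inDegree-reverse : ∀ v → inDegree (reverse w) v + 𝟙 (t ≟ v) ≡ inDegree O v + 𝟙 (s ≟ v)
    inDegree-reverse v = ∑-newHead (λ u → 𝟙 (u ≟ v)) w uniq

    -- `headsIn` gains a unit if `s` is in `X` and loses one if `t` is; since its sum with `d⁺` is
    -- invariant, `d⁺` changes the opposite way.
    d⁺-reverse : ∀ X → d⁺ (reverse w) X + 𝟙 (s ∈? X) ≡ d⁺ O X + 𝟙 (t ∈? X)
    d⁺-reverse X = +-cancelʳ-≡ (headsIn O X) _ _ (begin
      d₁ + 𝟙 (s ∈? X) + headsIn O X               ≡⟨ +-assoc d₁ _ _ ⟩
      d₁ + (𝟙 (s ∈? X) + headsIn O X)             ≡⟨ cong (d₁ +_) (+-comm (𝟙 (s ∈? X)) _) ⟩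
      d₁ + (headsIn O X + 𝟙 (s ∈? X))             ≡⟨ cong (d₁ +_) (∑-newHead (λ u → 𝟙 (u ∈? X)) w uniq) ⟨
      d₁ + (headsIn (reverse w) X + 𝟙 (t ∈? X))   ≡⟨ +-assoc d₁ _ _ ⟨
      d₁ + headsIn (reverse w) X + 𝟙 (t ∈? X)     ≡⟨ cong (_+ 𝟙 (t ∈? X)) (d⁺+headsIn-invariant (reverse w) O X) ⟩
      d⁺ O X + headsIn O X + 𝟙 (t ∈? X)           ≡⟨ +-assoc (d⁺ O X) _ _ ⟩
      d⁺ O X + (headsIn O X + 𝟙 (t ∈? X))         ≡⟨ cong (d⁺ O X +_) (+-comm (headsIn O X) _) ⟩
      d⁺ O X + (𝟙 (t ∈? X) + headsIn O X)         ≡⟨ +-assoc (d⁺ O X) _ _ ⟨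
      d⁺ O X + 𝟙 (t ∈? X) + headsIn O X           ∎)
      where
      open ≡-Reasoning
      d₁ = d⁺ (reverse w) X

module _ {k : ℕ} {H : Hypergraph} (O O′ : Orientation H) (conn : k -HyperarcConnected O) where

  pathStep : k -HyperarcConnected O′ → ∀ t → inDegree O′ t < inDegree O t →
             ∃[ O₁ ] ArisesByReversal O O₁ × k -HyperarcConnected O₁ × excess O₁ O′ < excess O O′
  pathStep conn′ t t-excess with Exchange.exchange O O′ conn conn′ t t-excess
  ... | s , s-deficit , slack = reverseWalk (reach (λ e u → u ∈? edge H e - headOf O e) s t)
    where
    T : Fin (#E H) → Fin (#V H) → Set
    T e u = u ∈ edge H e - headOf O e
    open Walks (headOf O) T
    open Reversal O {T} id

    s≢t : s ≢ t
    s≢t refl = <-asym s-deficit t-excess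

    reverseWalk : (∃[ es ] Walk s es t) ⊎ (∃[ X ] s ∈ X × t ∉ X × Closed X) →
                  ∃[ O₁ ] ArisesByReversal O O₁ × k -HyperarcConnected O₁ × excess O₁ O′ < excess O O′
    reverseWalk (inj₂ (X , s∈X , t∉X , closed))
      -- The slack gives `d⁺ O X > k ≥ 0`, so some hyperarc leaves `X`, which closedness forbids.
      with 0<∑⇒ _ (subst (0 <_) (d⁺≡∑ O X) (≤-<-trans z≤n (slack X s∈X t∉X)))
    ... | e , 0<𝟙 with 0<𝟙⇒ (leaves? X (arc O e)) 0<𝟙
    ...   | he∉X , u , u∈ with x∈p∩q⁻ _ X u∈
    ...     | u∈tail , u∈X = contradiction (closed u∈X u∈tail) he∉X
    reverseWalk (inj₁ ([] , [])) = contradiction refl s≢t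
    reverseWalk (inj₁ (_ ∷ _ , w₀)) with shorten w₀
    ... | es′ , w , uniqHeads = reverse w , reverse-arises w uniqHeads , connected₁ , ∑-mono-< excess-≤ t excess-<
      where
      uniq = Unique.map⁻ uniqHeads
      inDegree₁ : Fin (#V H) → ℕ
      inDegree₁ = inDegree (reverse w)

      connected₁ : k -HyperarcConnected reverse w
      connected₁ X X≢∅ X⊂⊤ with s ∈? X | t ∈? X | d⁺-reverse O {T} id w uniq X
      ... | yes _   | yes _  | eq = ≤-trans (conn X X≢∅ X⊂⊤) (≤-reflexive (sym (+-cancelʳ-≡ 1 _ _ eq)))
      ... | no _    | no _   | eq = ≤-trans (conn X X≢∅ X⊂⊤) (≤-reflexive (sym (+-cancelʳ-≡ 0 _ _ eq)))
      ... | no _    | yes _  | eq = ≤-trans (conn X X≢∅ X⊂⊤)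
        (≤-trans (m≤m+n _ 1) (≤-reflexive (trans (sym eq) (+-identityʳ _))))
      -- The only case in which `d⁺` drops; the slack at `s` pays for it.
      ... | yes s∈X | no t∉X | eq = +-cancelʳ-≤ 1 _ _ (begin
        k + 1                 ≡⟨ +-comm k 1 ⟩
        suc k                 ≤⟨ slack X s∈X t∉X ⟩
        d⁺ O X                ≡⟨ +-identityʳ _ ⟨
        d⁺ O X + 0            ≡⟨ eq ⟨
        d⁺ (reverse w) X + 1  ∎)
        where open ≤-Reasoning

      excess-≤ : ∀ v → inDegree₁ v ∸ inDegree O′ v ≤ inDegree O v ∸ inDegree O′ v
      excess-≤ v with s ≟ v | inDegree-reverse O {T} id w uniq v
      ... | no _     | eq = ∸-monoˡ-≤ (inDegree O′ v)
        (≤-trans (m≤m+n _ _) (≤-reflexive (trans eq (+-identityʳ _))))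
      -- The in-degree of `s` grows by one, but its deficit keeps it within the target, so its
      -- excess is zero.
      ... | yes refl | eq = ≤-trans (≤-reflexive (m≤n⇒m∸n≡0 (begin
        inDegree₁ s                ≤⟨ m≤m+n _ _ ⟩
        inDegree₁ s + 𝟙 (t ≟ s)    ≡⟨ eq ⟩
        inDegree O s + 1           ≡⟨ +-comm _ 1 ⟩
        suc (inDegree O s)         ≤⟨ s-deficit ⟩
        inDegree O′ s              ∎))) z≤n
        where open ≤-Reasoning

      inDegree-t : suc (inDegree₁ t) ≡ inDegree O t
      inDegree-t = begin
        suc (inDegree₁ t)          ≡⟨ +-comm 1 _ ⟩
        inDegree₁ t + 1            ≡⟨ cong (inDegree₁ t +_) (𝟙-yes (t ≟ t) refl) ⟨
        inDegree₁ t + 𝟙 (t ≟ t)    ≡⟨ inDegree-reverse O {T} id w uniq t ⟩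
        inDegree O t + 𝟙 (s ≟ t)   ≡⟨ cong (inDegree O t +_) (𝟙-no (s ≟ t) s≢t) ⟩
        inDegree O t + 0           ≡⟨ +-identityʳ _ ⟩
        inDegree O t               ∎
        where open ≡-Reasoning

      excess-< : inDegree₁ t ∸ inDegree O′ t < inDegree O t ∸ inDegree O′ t
      -- The surplus at `t` was at least one, so the new in-degree is still at least the target and
      -- truncation does not hide the decrease.
      excess-< = ∸-monoˡ-< (≤-reflexive inDegree-t)
        (s≤s⁻¹ (≤-trans t-excess (≤-reflexive (sym inDegree-t))))

  -- A cycle through a misoriented hyperedge exists in the digraph with an arc
  -- from the desired to the current head of every misoriented hyperedge: a set X
  -- closed under these arcs satisfies headsIn O′ X ≤ headsIn O X, while
  -- inDegree O ≤ inDegree O′ gives the converse.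
  cycleStep : (∀ v → inDegree O v ≤ inDegree O′ v) → ∀ e → headOf O e ≢ headOf O′ e →
              ∃[ O₁ ] ArisesByReversal O O₁ × k -HyperarcConnected O₁
                      × (∀ v → inDegree O₁ v ≤ inDegree O′ v) × mismatches O₁ O′ < mismatches O O′
  cycleStep le e he≢h′e = reverseWalk (reach T? (headOf O e) (headOf O′ e))
    where
    T : Fin (#E H) → Fin (#V H) → Set
    T f u = u ≡ headOf O′ f × u ≢ headOf O f
    T? : ∀ f u → Dec (T f u)
    T? f u = (u ≟ headOf O′ f) ×-dec ¬? (u ≟ headOf O f)
    T⇒tail : ∀ {f u} → T f u → u ∈ edge H f - headOf O f
    T⇒tail (refl , ≢) = x∈p∧x≢y⇒x∈p-y (headOf∈ O′ _) ≢
    open Walks (headOf O) T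
    open Reversal O {T} T⇒tail

    reverseWalk : (∃[ es ] Walk (headOf O e) es (headOf O′ e)) ⊎
                  (∃[ X ] headOf O e ∈ X × headOf O′ e ∉ X × Closed X) →
                  ∃[ O₁ ] ArisesByReversal O O₁ × k -HyperarcConnected O₁
                          × (∀ v → inDegree O₁ v ≤ inDegree O′ v) × mismatches O₁ O′ < mismatches O O′
    reverseWalk (inj₂ (X , he∈X , h′e∉X , closed)) = contradiction
      (headsIn-mono-≤ O O′ X (λ {v} _ → le v))
      (<⇒≱ (∑-mono-< (λ f → 𝟙-mono (headOf O′ f ∈? X) (headOf O f ∈? X) (pull f)) e gap))
      where
      pull : ∀ f → headOf O′ f ∈ X → headOf O f ∈ X
      pull f h′f∈X with headOf O′ f ≟ headOf O f
      ... | yes eq = subst (_∈ X) eq h′f∈X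
      ... | no ≢   = closed h′f∈X (refl , ≢)
      gap : 𝟙 (headOf O′ e ∈? X) < 𝟙 (headOf O e ∈? X)
      gap rewrite 𝟙-no (headOf O′ e ∈? X) h′e∉X | 𝟙-yes (headOf O e ∈? X) he∈X = z<s
    -- Entering `e` at its desired head and then following `w₀` closes the walk into a cycle.
    reverseWalk (inj₁ (_ , w₀)) with shorten ((refl , he≢h′e ∘ sym) ∷ w₀)
    ... | es′ , w , uniqHeads =
      reverse w , reverse-arises w uniqHeads , connected₁ , le₁ , ∑-mono-< mismatch-≤ e mismatch-<
      where
      uniq = Unique.map⁻ uniqHeads

      connected₁ : k -HyperarcConnected reverse w
      -- Both ends of the cycle are `headOf O′ e`, so the two indicators cancel and `d⁺` is
      -- unchanged.
      connected₁ X X≢∅ X⊂⊤ = subst (k ≤_)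
        (sym (+-cancelʳ-≡ (𝟙 (headOf O′ e ∈? X)) _ _ (d⁺-reverse O {T} T⇒tail w uniq X))) (conn X X≢∅ X⊂⊤)

      le₁ : ∀ v → inDegree (reverse w) v ≤ inDegree O′ v
      le₁ v = subst (_≤ inDegree O′ v)
        (sym (+-cancelʳ-≡ (𝟙 (headOf O′ e ≟ v)) _ _ (inDegree-reverse O {T} T⇒tail w uniq v))) (le v)

      mismatch-≤ : ∀ f → 𝟙 (¬? (headOf (reverse w) f ≟ headOf O′ f)) ≤ 𝟙 (¬? (headOf O f ≟ headOf O′ f))
      mismatch-≤ f = 𝟙-mono (¬? (headOf (reverse w) f ≟ headOf O′ f)) (¬? (headOf O f ≟ headOf O′ f)) still
        where
        still : headOf (reverse w) f ≢ headOf O′ f → headOf O f ≢ headOf O′ f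
        still ≢ with newHead-case w f
        ... | inj₁ eq       = subst (_≢ headOf O′ f) eq ≢
        ... | inj₂ (eq , _) = contradiction eq ≢

      mismatch-< : 𝟙 (¬? (headOf (reverse w) e ≟ headOf O′ e)) < 𝟙 (¬? (headOf O e ≟ headOf O′ e))
      -- `shorten` keeps `e` as the first hyperedge, so its new head is the start `headOf O′ e`.
      mismatch-<
        rewrite 𝟙-no (¬? (headOf (reverse w) e ≟ headOf O′ e)) (λ ≢ → ≢ (newHead-here _ e es′))
              | 𝟙-yes (¬? (headOf O e ≟ headOf O′ e)) he≢h′e = z<s

module _ {k : ℕ} {H : Hypergraph} (O′ : Orientation H) where

  -- The inequality is what the absence of surplus vertices provides. Both in-degree sums equal the
  -- number of hyperedges, so it amounts to equality of in-degrees.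
  reverseCycles : ∀ O → Acc _<_ (mismatches O O′) → k -HyperarcConnected O →
                  (∀ v → inDegree O v ≤ inDegree O′ v) → ReversalSequence k O O′
  reverseCycles O (acc rec) conn le with any? (λ e → ¬? (headOf O e ≟ headOf O′ e))
  ... | no all≡ = stop conn (λ e → decidable-stable (headOf O e ≟ headOf O′ e) (λ ≢ → all≡ (e , ≢)))
  ... | yes (e , ≢) with cycleStep O O′ conn le e ≢
  ...   | O₁ , arises , conn₁ , le₁ , lt = conn , arises ◅ reverseCycles O₁ (rec lt) conn₁ le₁

  reversePaths : k -HyperarcConnected O′ → ∀ O → Acc _<_ (excess O O′) → k -HyperarcConnected O →
                 ReversalSequence k O O′
  reversePaths conn′ O (acc rec) conn with any? (λ t → inDegree O′ t <? inDegree O t)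
  ... | no ¬excess = reverseCycles O (<-wellFounded _) conn (λ v → ≮⇒≥ (λ lt → ¬excess (v , lt)))
  ... | yes (t , t-excess) with pathStep O O′ conn conn′ t t-excess
  ...   | O₁ , arises , conn₁ , lt = conn , arises ◅ reversePaths conn′ O₁ (rec lt) conn₁

mainTheorem3 : (k : ℕ) (H : Hypergraph) (O O′ : Orientation H) → k -HyperarcConnected O → k -HyperarcConnected O′ → ReversalSequence k O O′
mainTheorem3 k H O O′ conn conn′ = reversePaths O′ conn′ O (<-wellFounded _) conn
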